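{- Let $a,b$ be coprime positive integers. For every integer $n\ge 1$, $$\{k+(n-1)ab:\ k\in Ap_{ab}(S_{a,b})\}=R_n(a,b).$$
   Context: For coprime positive integers $a,b$, $S_{a,b}=\{ua+vb:\ u,v\in\mathbb{Z}_{\ge 0}\}$ is the numerical semigroup generated by $a$ and $b$. For a nonzero $m\in S_{a,b}$ the Apéry set is $Ap_m(S_{a,b}):=\{s\in S_{a,b}:\ s-m\notin S_{a,b}\}$. $R_n(a,b)$ is the set of all elements of $S_{a,b}$ having exactly $n$ representations as a linear combination $ua+vb$ of the generators with $u,v\in\mathbb{Z}_{\ge 0}$ (representations are counted as pairs $(u,v)$). -}

module Defs where

open import Level using (0ℓ)
open import Data.Nat.Base using (ℕ)
open import Data.Integer.Base using (ℤ; +_; _+_; _*_; _-_)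
open import Data.Fin.Base using (Fin)
open import Data.Product.Base using (Σ-syntax; _×_; _,_)
open import Function.Bundles using (_↔_)
open import Relation.Binary.PropositionalEquality.Core using (_≡_)
open import Relation.Unary using (Pred; _∈_; _∉_)

-- Semigroups are subsets of ℤ (here automatically contained in the
-- nonnegative integers), so that s - m below is genuine subtraction.

Representation : ℕ → ℕ → ℤ → Set
Representation a b s =
  Σ[ (u , v) ∈ ℕ × ℕ ] (s ≡ + u * + a + + v * + b)

S : ℕ → ℕ → Pred ℤ 0ℓ
S a b s = Representation a b s

-- Usually considered only for nonzero m ∈ T.
Ap : ℤ → Pred ℤ 0ℓ → Pred ℤ 0ℓ
Ap m T s = s ∈ T × (s - m) ∉ T

-- Equality proofs in ℤ are unique, so a bijection from
-- Representation a b s counts the pairs (u , v).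
R : ℕ → ℕ → ℕ → Pred ℤ 0ℓ
R n a b s = s ∈ S a b × (Representation a b s ↔ Fin n)

{-# OPTIONS --safe #-}
-- Two representations (u , v), (u′ , v′) of the same number satisfy
-- u ≡ u′ (mod b) and v ≡ v′ (mod a) by coprimality, hence they also share the
-- level u / b + v / a.  So the representations of u a + v b are exactly the
-- (u % b + i b , v % a + j a) with i + j equal to the level, which is one less
-- than their number.  The Apéry elements are those of level 0, and
-- adding ab raises the level by 1.
module Submission where

open import Defs
open import Data.Nat.Base using (ℕ; NonZero; _≥_)
open import Data.Nat.Coprimality using (Coprime)
open import Data.Integer.Base using (ℤ; +_; _+_; _*_; _-_)
open import Data.Product.Base using (_×_; ∃-syntax)
open import Relation.Binary.PropositionalEquality.Core using (_≡_)
open import Relation.Unary using (_∈_; _≐_)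

open import Axiom.UniquenessOfIdentityProofs using (module Decidable⇒UIP)
open import Data.Nat.Base as ℕ using (zero; suc; s≤s; _/_; _%_; _∸_; _≤_; _<_)
open import Data.Nat.Coprimality using (coprime-divisor)
  renaming (sym to coprime-sym)
open import Data.Nat.Divisibility using (_∣_; n∣m*n; ∣m+n∣m⇒∣n)
open import Data.Nat.DivMod
  using (+-distrib-/-∣ʳ; m<n⇒m/n≡0; m*n/n≡m; %-remove-+ʳ; m≡m%n+[m/n]*n; m%n<n)
import Data.Nat.Properties as ℕ
import Data.Nat.Tactic.RingSolver as ℕ-Solver
import Data.Integer.Properties as ℤ
import Data.Integer.Tactic.RingSolver as ℤ-Solver
open import Data.Fin.Base using (Fin; toℕ; fromℕ<)
open import Data.Fin.Properties using (toℕ<n; toℕ-fromℕ<; toℕ-injective)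
open import Data.Fin.Permutation using (↔⇒≡)
open import Data.Product.Base using (_,_; proj₁)
open import Data.Product.Properties using (Σ-≡,≡→≡)
open import Data.Sum.Base using (inj₁; inj₂)
open import Function.Bundles using (_↔_; mk↔ₛ′)
open import Function.Construct.Composition using (_↔-∘_)
open import Function.Construct.Symmetry using (↔-sym)
open import Relation.Binary.PropositionalEquality.Core
  using (refl; sym; trans; cong; cong₂; subst)
open import Relation.Binary.PropositionalEquality.Properties using (module ≡-Reasoning)
open import Relation.Nullary.Negation using (contradiction)

-- Congruences between pairs with equal values.

value : ℕ → ℕ → ℕ → ℕ → ℕ
value a b u v = u ℕ.* a ℕ.+ v ℕ.* b

value-swap : ∀ a b u v → value b a v u ≡ value a b u v
value-swap a b u v = ℕ.+-comm (v ℕ.* b) (u ℕ.* a)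

[m+kn]/n≡k : ∀ {m n} k .{{_ : NonZero n}} → m < n → (m ℕ.+ k ℕ.* n) / n ≡ k
[m+kn]/n≡k {m} {n} k m<n = begin
  (m ℕ.+ k ℕ.* n) / n       ≡⟨ +-distrib-/-∣ʳ m (n∣m*n k) ⟩
  m / n ℕ.+ k ℕ.* n / n     ≡⟨ cong₂ ℕ._+_ (m<n⇒m/n≡0 m<n) (m*n/n≡m k n) ⟩
  k                         ∎
  where open ≡-Reasoning

-- Cancelling `u ℕ.* a` on both sides leaves `v b = v′ b + a d` with `d = u′ ∸ u`, so `b` divides
-- `a d` and, by coprimality, `d`. The order hypothesis makes the truncated subtraction genuine.
value-%-≤ : ∀ {a b} u v u′ v′ .{{_ : NonZero b}} → Coprime a b → u ≤ u′ →
            value a b u v ≡ value a b u′ v′ → u % b ≡ u′ % b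
value-%-≤ {a} {b} u v u′ v′ a⊥b u≤u′ eq = begin
  u % b                    ≡⟨ %-remove-+ʳ u b∣d ⟨
  (u ℕ.+ d) % b            ≡⟨ cong (_% b) u+d≡u′ ⟩
  u′ % b                   ∎
  where
  open ≡-Reasoning
  d = u′ ∸ u

  u+d≡u′ : u ℕ.+ d ≡ u′
  u+d≡u′ = ℕ.m+[n∸m]≡n u≤u′

  regroup : ∀ u d a w → (u ℕ.+ d) ℕ.* a ℕ.+ w ≡ u ℕ.* a ℕ.+ (w ℕ.+ a ℕ.* d)
  regroup = ℕ-Solver.solve-∀

  vb≡v′b+ad : v ℕ.* b ≡ v′ ℕ.* b ℕ.+ a ℕ.* d
  vb≡v′b+ad = ℕ.+-cancelˡ-≡ (u ℕ.* a) _ _ (begin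
    value a b u v                             ≡⟨ eq ⟩
    value a b u′ v′                           ≡⟨ cong (λ x → value a b x v′) u+d≡u′ ⟨
    value a b (u ℕ.+ d) v′                    ≡⟨ regroup u d a (v′ ℕ.* b) ⟩
    u ℕ.* a ℕ.+ (v′ ℕ.* b ℕ.+ a ℕ.* d)        ∎)

  b∣d : b ∣ d
  b∣d = coprime-divisor (coprime-sym a⊥b)
    (∣m+n∣m⇒∣n (subst (b ∣_) vb≡v′b+ad (n∣m*n v)) (n∣m*n v′))

value-% : ∀ {a b} u v u′ v′ .{{_ : NonZero b}} → Coprime a b →
          value a b u v ≡ value a b u′ v′ → u % b ≡ u′ % b
value-% u v u′ v′ a⊥b eq with ℕ.≤-total u u′
... | inj₁ u≤u′ = value-%-≤ u v u′ v′ a⊥b u≤u′ eq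
... | inj₂ u′≤u = sym (value-%-≤ u′ v′ u v a⊥b u′≤u (sym eq))

-- Arithmetic of the level.

module _ (a b : ℕ) .{{_ : NonZero a}} .{{_ : NonZero b}} where

  level : ℕ → ℕ → ℕ
  level u v = u / b ℕ.+ v / a

  -- A `b` added to the first coordinate and an `a` added to the second both contribute `ab`, so
  -- only the sum `i ℕ.+ j` matters. This is the source of the multiple representations.
  value-shift : ∀ r i t j →
    value a b (r ℕ.+ i ℕ.* b) (t ℕ.+ j ℕ.* a) ≡ value a b r t ℕ.+ (i ℕ.+ j) ℕ.* (a ℕ.* b)
  value-shift = shift a b
    where
    shift : ∀ a b r i t j →
      (r ℕ.+ i ℕ.* b) ℕ.* a ℕ.+ (t ℕ.+ j ℕ.* a) ℕ.* b ≡
      r ℕ.* a ℕ.+ t ℕ.* b ℕ.+ (i ℕ.+ j) ℕ.* (a ℕ.* b)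
    shift = ℕ-Solver.solve-∀

  value-normal : ∀ u v → value a b u v ≡ value a b (u % b) (v % a) ℕ.+ level u v ℕ.* (a ℕ.* b)
  value-normal u v = trans
    (cong₂ (value a b) (m≡m%n+[m/n]*n u b) (m≡m%n+[m/n]*n v a))
    (value-shift (u % b) (u / b) (v % a) (v / a))

  level-% : ∀ u v → level (u % b) (v % a) ≡ 0
  level-% u v = cong₂ ℕ._+_ (m<n⇒m/n≡0 (m%n<n u b)) (m<n⇒m/n≡0 (m%n<n v a))

  level-+ : ∀ u v k → level (u ℕ.+ k ℕ.* b) v ≡ k ℕ.+ level u v
  level-+ u v k = begin
    (u ℕ.+ k ℕ.* b) / b ℕ.+ v / a       ≡⟨ cong (ℕ._+ v / a) (+-distrib-/-∣ʳ u (n∣m*n k)) ⟩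
    u / b ℕ.+ k ℕ.* b / b ℕ.+ v / a     ≡⟨ cong (λ x → u / b ℕ.+ x ℕ.+ v / a) (m*n/n≡m k b) ⟩
    u / b ℕ.+ k ℕ.+ v / a               ≡⟨ cong (ℕ._+ v / a) (ℕ.+-comm (u / b) k) ⟩
    k ℕ.+ u / b ℕ.+ v / a               ≡⟨ ℕ.+-assoc k (u / b) (v / a) ⟩
    k ℕ.+ level u v                     ∎
    where open ≡-Reasoning

  -- A positive level lets one copy of `ab` be split off. The other `m` copies are all put in the
  -- first coordinate, which gives an explicit pair for the difference.
  value-lower : ∀ u v {m} → level u v ≡ suc m →
    value a b u v ≡ value a b (u % b ℕ.+ m ℕ.* b) (v % a) ℕ.+ a ℕ.* b
  value-lower u v {m} lvl = begin
    value a b u v                                          ≡⟨ value-normal u v ⟩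
    value a b (u % b) (v % a) ℕ.+ level u v ℕ.* (a ℕ.* b)  ≡⟨ cong (λ l → value a b (u % b) (v % a) ℕ.+ l ℕ.* (a ℕ.* b)) lvl ⟩
    value a b (u % b) (v % a) ℕ.+ suc m ℕ.* (a ℕ.* b)      ≡⟨ lower a b (u % b) (v % a) m ⟩
    value a b (u % b ℕ.+ m ℕ.* b) (v % a) ℕ.+ a ℕ.* b      ∎
    where
    open ≡-Reasoning
    lower : ∀ a b r t m → r ℕ.* a ℕ.+ t ℕ.* b ℕ.+ (1 ℕ.+ m) ℕ.* (a ℕ.* b) ≡
                          (r ℕ.+ m ℕ.* b) ℕ.* a ℕ.+ t ℕ.* b ℕ.+ a ℕ.* b
    lower = ℕ-Solver.solve-∀

  value-+ : ∀ u v k → value a b (u ℕ.+ k ℕ.* b) v ≡ value a b u v ℕ.+ k ℕ.* (a ℕ.* b)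
  value-+ u v k = raise a b u v k
    where
    raise : ∀ a b u v k → (u ℕ.+ k ℕ.* b) ℕ.* a ℕ.+ v ℕ.* b ≡
                          u ℕ.* a ℕ.+ v ℕ.* b ℕ.+ k ℕ.* (a ℕ.* b)
    raise = ℕ-Solver.solve-∀

  pos-value : ∀ u v → + value a b u v ≡ + u * + a + + v * + b
  pos-value u v = cong₂ _+_ (ℤ.pos-* u a) (ℤ.pos-* v b)

  pos-+-* : ∀ m k → + (m ℕ.+ k ℕ.* (a ℕ.* b)) ≡ + m + + k * (+ a * + b)
  pos-+-* m k = cong (_+_ (+ m)) (trans (ℤ.pos-* k (a ℕ.* b)) (cong (+ k *_) (ℤ.pos-* a b)))

  representation : ∀ {s} u v → s ≡ + value a b u v → Representation a b s
  representation u v eq = (u , v) , trans eq (pos-value u v)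

  representation-≡ : ∀ {s} {ρ σ : Representation a b s} → proj₁ ρ ≡ proj₁ σ → ρ ≡ σ
  representation-≡ eq = Σ-≡,≡→≡ (eq , Decidable⇒UIP.≡-irrelevant ℤ._≟_ _ _)

  -- Consequences of coprimality: counting representations and recognising Apéry elements.

  module _ (a⊥b : Coprime a b) where

    value-%ˡ : ∀ u v u′ v′ → value a b u v ≡ value a b u′ v′ → u % b ≡ u′ % b
    value-%ˡ u v u′ v′ = value-% u v u′ v′ a⊥b

    value-%ʳ : ∀ u v u′ v′ → value a b u v ≡ value a b u′ v′ → v % a ≡ v′ % a
    value-%ʳ u v u′ v′ eq = value-% v u v′ u′ (coprime-sym a⊥b)
      (trans (value-swap a b u v) (trans eq (sym (value-swap a b u′ v′))))

    -- The residues agree, so the normal forms differ at most in their multiples of `ab`, and the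
    -- nonzero factor `ab` cancels. The level thus becomes an invariant of the represented number.
    value-level : ∀ u v u′ v′ → value a b u v ≡ value a b u′ v′ → level u v ≡ level u′ v′
    value-level u v u′ v′ eq =
      ℕ.*-cancelʳ-≡ _ _ (a ℕ.* b) {{ℕ.m*n≢0 a b}} (ℕ.+-cancelˡ-≡ (value a b (u % b) (v % a)) _ _ (begin
        value a b (u % b) (v % a) ℕ.+ level u v ℕ.* (a ℕ.* b)        ≡⟨ value-normal u v ⟨
        value a b u v                                                ≡⟨ eq ⟩
        value a b u′ v′                                              ≡⟨ value-normal u′ v′ ⟩
        value a b (u′ % b) (v′ % a) ℕ.+ level u′ v′ ℕ.* (a ℕ.* b)    ≡⟨ cong (ℕ._+ level u′ v′ ℕ.* (a ℕ.* b)) residues ⟨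
        value a b (u % b) (v % a) ℕ.+ level u′ v′ ℕ.* (a ℕ.* b)      ∎))
      where
      open ≡-Reasoning
      residues : value a b (u % b) (v % a) ≡ value a b (u′ % b) (v′ % a)
      residues = cong₂ (value a b) (value-%ˡ u v u′ v′ eq) (value-%ʳ u v u′ v′ eq)

    -- A representation `(u′ , v′)` is indexed by `u′ / b`. Its residues are those of the given pair
    -- and its two quotients sum to `N`, so this index determines it and runs over `0` to `N`
    -- inclusive, hence the `suc`.
    representations↔ : ∀ {s} u v → s ≡ + value a b u v →
                       Representation a b s ↔ Fin (suc (level u v))
    representations↔ {s} u v s≡ = mk↔ₛ′ to from to∘from from∘to
      where
      open ≡-Reasoning
      N = level u v

      same-value : ∀ (((u′ , v′) , _) : Representation a b s) → value a b u v ≡ value a b u′ v′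
      same-value ((u′ , v′) , eq) = ℤ.+-injective (trans (sym s≡) (trans eq (sym (pos-value u′ v′))))

      u/b≤N : ∀ (((u′ , _) , _) : Representation a b s) → u′ / b ≤ N
      u/b≤N ρ@((u′ , v′) , _) =
        subst (u′ / b ≤_) (sym (value-level u v u′ v′ (same-value ρ))) (ℕ.m≤m+n (u′ / b) (v′ / a))

      to : Representation a b s → Fin (suc N)
      to ρ = fromℕ< (s≤s (u/b≤N ρ))

      -- Of the `N` copies of `ab` in the normal form, `j` go to the first coordinate and the
      -- remaining `N ∸ j` to the second.
      from : Fin (suc N) → Representation a b s
      from i = representation (u % b ℕ.+ j ℕ.* b) (v % a ℕ.+ (N ∸ j) ℕ.* a) (trans s≡ (cong +_ (begin
        value a b u v                                                ≡⟨ value-normal u v ⟩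
        value a b (u % b) (v % a) ℕ.+ N ℕ.* (a ℕ.* b)                ≡⟨ cong (λ l → value a b (u % b) (v % a) ℕ.+ l ℕ.* (a ℕ.* b)) (ℕ.m+[n∸m]≡n j≤N) ⟨
        value a b (u % b) (v % a) ℕ.+ (j ℕ.+ (N ∸ j)) ℕ.* (a ℕ.* b)  ≡⟨ value-shift (u % b) j (v % a) (N ∸ j) ⟨
        value a b (u % b ℕ.+ j ℕ.* b) (v % a ℕ.+ (N ∸ j) ℕ.* a)      ∎)))
        where
        j = toℕ i
        j≤N : j ≤ N
        j≤N = ℕ.s≤s⁻¹ (toℕ<n i)

      to∘from : ∀ i → to (from i) ≡ i
      to∘from i = toℕ-injective (trans (toℕ-fromℕ< _) ([m+kn]/n≡k (toℕ i) (m%n<n u b)))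

      from∘to : ∀ ρ → from (to ρ) ≡ ρ
      from∘to ρ@((u′ , v′) , _) = representation-≡ (cong₂ _,_
        (begin
          u % b ℕ.+ toℕ (to ρ) ℕ.* b     ≡⟨ cong₂ (λ r i → r ℕ.+ i ℕ.* b) (value-%ˡ u v u′ v′ (same-value ρ)) to≡ ⟩
          u′ % b ℕ.+ (u′ / b) ℕ.* b      ≡⟨ m≡m%n+[m/n]*n u′ b ⟨
          u′                             ∎)
        (begin
          v % a ℕ.+ (N ∸ toℕ (to ρ)) ℕ.* a   ≡⟨ cong₂ (λ r i → r ℕ.+ i ℕ.* a) (value-%ʳ u v u′ v′ (same-value ρ)) N∸to≡ ⟩
          v′ % a ℕ.+ (v′ / a) ℕ.* a          ≡⟨ m≡m%n+[m/n]*n v′ a ⟨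
          v′                                 ∎))
        where
        to≡ : toℕ (to ρ) ≡ u′ / b
        to≡ = toℕ-fromℕ< _

        -- `N` is also the level of `(u′ , v′)`, so taking away `u′ / b` leaves the other quotient.
        N∸to≡ : N ∸ toℕ (to ρ) ≡ v′ / a
        N∸to≡ = begin
          N ∸ toℕ (to ρ)           ≡⟨ cong₂ _∸_ (value-level u v u′ v′ (same-value ρ)) to≡ ⟩
          level u′ v′ ∸ u′ / b     ≡⟨ ℕ.m+n∸m≡n (u′ / b) (v′ / a) ⟩
          v′ / a                   ∎

    -- At level `suc m`, `value-lower` would exhibit a representation of the number minus `ab`,
    -- which membership in the Apéry set forbids.
    Ap⇒level≡0 : ∀ u v → + value a b u v ∈ Ap (+ a * + b) (S a b) → level u v ≡ 0
    Ap⇒level≡0 u v (_ , k-ab∉S) with level u v in lvl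
    ... | zero  = refl
    ... | suc m = contradiction (representation (u % b ℕ.+ m ℕ.* b) (v % a) (begin
        + value a b u v - + a * + b      ≡⟨ cong (λ x → + x - + a * + b) (value-lower u v lvl) ⟩
        + w + + (a ℕ.* b) - + a * + b    ≡⟨ cong (λ x → + w + x - + a * + b) (ℤ.pos-* a b) ⟩
        + w + + a * + b - + a * + b      ≡⟨ cancel (+ w) (+ a * + b) ⟩
        + w                              ∎)) k-ab∉S
      where
      open ≡-Reasoning
      w = value a b (u % b ℕ.+ m ℕ.* b) (v % a)
      cancel : ∀ x y → x + y - y ≡ x
      cancel = ℤ-Solver.solve-∀

    -- If subtracting `ab` left a number represented by `(u′ , v′)`, then `(u′ ℕ.+ b , v′)` would
    -- represent the original one at a positive level, against the invariance of the level.
    level≡0⇒Ap : ∀ u v → level u v ≡ 0 → + value a b u v ∈ Ap (+ a * + b) (S a b)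
    level≡0⇒Ap u v lvl = representation u v refl , λ ((u′ , v′) , eq) →
      ℕ.1+n≢0 (begin
        1 ℕ.+ level u′ v′             ≡⟨ level-+ u′ v′ 1 ⟨
        level (u′ ℕ.+ 1 ℕ.* b) v′     ≡⟨ value-level u v (u′ ℕ.+ 1 ℕ.* b) v′ (raised u′ v′ eq) ⟨
        level u v                     ≡⟨ lvl ⟩
        0                             ∎)
      where
      open ≡-Reasoning
      -- The factor `+ 1` is kept so that `pos-+-*` and `value-+` apply with `k = 1`.
      uncancel : ∀ x y → x ≡ x - y + + 1 * y
      uncancel = ℤ-Solver.solve-∀

      raised : ∀ u′ v′ → + value a b u v - + a * + b ≡ + u′ * + a + + v′ * + b →
               value a b u v ≡ value a b (u′ ℕ.+ 1 ℕ.* b) v′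
      raised u′ v′ eq = ℤ.+-injective (begin
        + value a b u v                                        ≡⟨ uncancel (+ value a b u v) (+ a * + b) ⟩
        + value a b u v - + a * + b + + 1 * (+ a * + b)        ≡⟨ cong (_+ + 1 * (+ a * + b)) (trans eq (sym (pos-value u′ v′))) ⟩
        + value a b u′ v′ + + 1 * (+ a * + b)                  ≡⟨ pos-+-* (value a b u′ v′) 1 ⟨
        + (value a b u′ v′ ℕ.+ 1 ℕ.* (a ℕ.* b))                ≡⟨ cong +_ (value-+ u′ v′ 1) ⟨
        + value a b (u′ ℕ.+ 1 ℕ.* b) v′                        ∎)

mainTheorem2 : (a b : ℕ) → .{{_ : NonZero a}} → .{{_ : NonZero b}} → Coprime a b →
    (n : ℕ) → n ≥ 1 →
    (λ (x : ℤ) → ∃[ k ] (k ∈ Ap (+ a * + b) (S a b) × x ≡ k + (+ n - + 1) * (+ a * + b)))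
    ≐ R n a b
mainTheorem2 a b a⊥b (suc m) _ = Ap⊆R , R⊆Ap
  where
  open ≡-Reasoning

  -- For `n = suc m` the coefficient `+ n - + 1` computes to `+ m`. Putting all `m` copies of `ab`
  -- in the first coordinate raises the level from `0` to `m`, which gives `suc m` representations.
  Ap⊆R : ∀ {x} → ∃[ k ] (k ∈ Ap (+ a * + b) (S a b) × x ≡ k + + m * (+ a * + b)) →
         x ∈ R (suc m) a b
  Ap⊆R {x} (k , k∈Ap@(((u , v) , k≡) , _) , x≡) =
    representation a b (u ℕ.+ m ℕ.* b) v x≡value ,
    subst (λ l → Representation a b x ↔ Fin (suc l)) lvl
      (representations↔ a b a⊥b (u ℕ.+ m ℕ.* b) v x≡value)
    where
    k≡value : k ≡ + value a b u v
    k≡value = trans k≡ (sym (pos-value a b u v))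

    x≡value : x ≡ + value a b (u ℕ.+ m ℕ.* b) v
    x≡value = begin
      x                                        ≡⟨ x≡ ⟩
      k + + m * (+ a * + b)                    ≡⟨ cong (_+ + m * (+ a * + b)) k≡value ⟩
      + value a b u v + + m * (+ a * + b)      ≡⟨ pos-+-* a b (value a b u v) m ⟨
      + (value a b u v ℕ.+ m ℕ.* (a ℕ.* b))    ≡⟨ cong +_ (value-+ a b u v m) ⟨
      + value a b (u ℕ.+ m ℕ.* b) v            ∎

    lvl : level a b (u ℕ.+ m ℕ.* b) v ≡ m
    lvl = begin
      level a b (u ℕ.+ m ℕ.* b) v    ≡⟨ level-+ a b u v m ⟩
      m ℕ.+ level a b u v            ≡⟨ cong (m ℕ.+_) (Ap⇒level≡0 a b a⊥b u v (subst (_∈ Ap (+ a * + b) (S a b)) k≡value k∈Ap)) ⟩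
      m ℕ.+ 0                        ≡⟨ ℕ.+-identityʳ m ⟩
      m                              ∎

  R⊆Ap : ∀ {x} → x ∈ R (suc m) a b →
         ∃[ k ] (k ∈ Ap (+ a * + b) (S a b) × x ≡ k + + m * (+ a * + b))
  R⊆Ap {x} (((u , v) , x≡) , reps↔) =
    -- Reducing both coordinates strips every copy of `ab` and leaves a pair of level `0`, hence an
    -- Apéry element.
    + value a b (u % b) (v % a) ,
    level≡0⇒Ap a b a⊥b (u % b) (v % a) (level-% a b u v) ,
    (begin
      x                                                                ≡⟨ x≡value ⟩
      + value a b u v                                                  ≡⟨ cong +_ (value-normal a b u v) ⟩
      + (value a b (u % b) (v % a) ℕ.+ level a b u v ℕ.* (a ℕ.* b))    ≡⟨ cong (λ l → + (value a b (u % b) (v % a) ℕ.+ l ℕ.* (a ℕ.* b))) lvl ⟩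
      + (value a b (u % b) (v % a) ℕ.+ m ℕ.* (a ℕ.* b))                ≡⟨ pos-+-* a b (value a b (u % b) (v % a)) m ⟩
      + value a b (u % b) (v % a) + + m * (+ a * + b)                  ∎)
    where
    x≡value : x ≡ + value a b u v
    x≡value = trans x≡ (sym (pos-value a b u v))

    -- The given count and `representations↔` enumerate the same type, so composing them yields a
    -- bijection between `Fin (suc (level a b u v))` and `Fin (suc m)`, which forces equal sizes.
    lvl : level a b u v ≡ m
    lvl = ℕ.suc-injective (↔⇒≡ (reps↔ ↔-∘ ↔-sym (representations↔ a b a⊥b u v x≡value)))
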